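{- Let $(L,\sqsubseteq)$ be a complete lattice with top $\top$ and bottom $\bot$, and let $F:L\to L$ be a monotone function. Then: (1) $\mathit{Gen}(F,\top)$ is the greatest fixed point of $F$; (2) $\mathit{Gen}(F,\bot)$ is the least fixed point of $F$.
   Context: The closure of $F$ is $\nabla_F(x)=\inf\{y\in L\mid F(y)\sqsubseteq y,\ x\sqsubseteq y\}$ and the kernel of $F$ is $\Delta_F(x)=\bigsqcup\{y\in L\mid y\sqsubseteq F(y),\ y\sqsubseteq x\}$. For $\gamma\in L$, the bounded fixed point of $F$ generated by $\gamma$ is $\mathit{Gen}(F,\gamma)=\Delta_F(\nabla_F(\gamma))$. -}

module Defs where

open import Data.Product.Base using (_×_)
open import Level using (Level; suc; _⊔_)
open import Relation.Binary.Core using (Rel)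
open import Relation.Binary.Structures using (IsPartialOrder)
open import Relation.Unary using (Pred; _∈_)

module _ {a ℓ p : Level} {A : Set a} (_≤_ : Rel A ℓ) where

  IsSupremum : Pred A p → A → Set (a ⊔ ℓ ⊔ p)
  IsSupremum P s = (∀ y → y ∈ P → y ≤ s) × (∀ u → (∀ y → y ∈ P → y ≤ u) → s ≤ u)

  IsInfimum : Pred A p → A → Set (a ⊔ ℓ ⊔ p)
  IsInfimum P i = (∀ y → y ∈ P → i ≤ y) × (∀ l → (∀ y → y ∈ P → l ≤ y) → l ≤ i)

-- Subsets of the carrier are predicates.  Their universe level is that of the
-- order: this is the least level at which the sets of pre- and post-fixed
-- points used below can be formed.
record CompleteLattice (c ℓ₁ ℓ₂ : Level) : Set (suc (c ⊔ ℓ₁ ⊔ ℓ₂)) where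
  infix 4 _≈_ _⊑_
  field
    Carrier        : Set c
    _≈_            : Rel Carrier ℓ₁
    _⊑_            : Rel Carrier ℓ₂
    isPartialOrder : IsPartialOrder _≈_ _⊑_
    ⨆              : Pred Carrier ℓ₂ → Carrier
    ⨅              : Pred Carrier ℓ₂ → Carrier
    supremum       : (P : Pred Carrier ℓ₂) → IsSupremum _⊑_ P (⨆ P)
    infimum        : (P : Pred Carrier ℓ₂) → IsInfimum _⊑_ P (⨅ P)

  open IsPartialOrder isPartialOrder public

module _ {c ℓ₁ ℓ₂ : Level} (L : CompleteLattice c ℓ₁ ℓ₂) where
  open CompleteLattice L

  IsFixedPoint : (Carrier → Carrier) → Carrier → Set ℓ₁
  IsFixedPoint F x = F x ≈ x

  IsGreatestFixedPoint : (Carrier → Carrier) → Carrier → Set (c ⊔ ℓ₁ ⊔ ℓ₂)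
  IsGreatestFixedPoint F x = IsFixedPoint F x × (∀ y → IsFixedPoint F y → y ⊑ x)

  IsLeastFixedPoint : (Carrier → Carrier) → Carrier → Set (c ⊔ ℓ₁ ⊔ ℓ₂)
  IsLeastFixedPoint F x = IsFixedPoint F x × (∀ y → IsFixedPoint F y → x ⊑ y)

  closure : (Carrier → Carrier) → Carrier → Carrier
  closure F x = ⨅ (λ y → F y ⊑ y × x ⊑ y)

  kernel : (Carrier → Carrier) → Carrier → Carrier
  kernel F x = ⨆ (λ y → y ⊑ F y × y ⊑ x)

  Gen : (Carrier → Carrier) → Carrier → Carrier
  Gen F γ = kernel F (closure F γ)

{-# OPTIONS --safe #-}
-- For monotone F the closure of any γ is a pre-fixed point, and the kernel of a
-- pre-fixed point is a fixed point (Knaster–Tarski below that point), so every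
-- Gen(F, γ) is a fixed point.  Extremality at ⊤ and ⊥ is then immediate from
-- ⊤ ⊑ ∇(⊤) and from ∇(⊥) being a lower bound of all pre-fixed points.
module Submission where

open import Defs
open import Data.Product.Base using (_×_; _,_; proj₁; proj₂)
open import Relation.Binary.Definitions using (Maximum; Minimum; Monotonic₁)

module _ {c ℓ₁ ℓ₂} (L : CompleteLattice c ℓ₁ ℓ₂) where
  open CompleteLattice L

  module _ (F : Carrier → Carrier) where

    closure-extensive : ∀ x → x ⊑ closure L F x
    closure-extensive x = proj₂ (infimum _) x λ _ → proj₂

    closure-least : ∀ {x y} → F y ⊑ y → x ⊑ y → closure L F x ⊑ y
    closure-least Fy⊑y x⊑y = proj₁ (infimum _) _ (Fy⊑y , x⊑y)

    kernel-reductive : ∀ x → kernel L F x ⊑ x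
    kernel-reductive x = proj₂ (supremum _) x λ _ → proj₂

    kernel-greatest : ∀ {x y} → y ⊑ F y → y ⊑ x → y ⊑ kernel L F x
    kernel-greatest y⊑Fy y⊑x = proj₁ (supremum _) _ (y⊑Fy , y⊑x)

    module _ (F-mono : Monotonic₁ _⊑_ _⊑_ F) where

      -- Each `y` in the set defining `closure L F x` lies above the closure, so monotonicity puts
      -- `F (closure L F x)` below `F y ⊑ y`: it is a lower bound of that set.
      closure-prefixed : ∀ x → F (closure L F x) ⊑ closure L F x
      closure-prefixed x = proj₂ (infimum _) _ λ _ (Fy⊑y , x⊑y) →
        trans (F-mono (closure-least Fy⊑y x⊑y)) Fy⊑y

      kernel-postfixed : ∀ x → kernel L F x ⊑ F (kernel L F x)
      kernel-postfixed x = proj₂ (supremum _) _ λ _ (y⊑Fy , y⊑x) →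
        trans y⊑Fy (F-mono (kernel-greatest y⊑Fy y⊑x))

      -- `F (kernel L F x)` is itself post-fixed by monotonicity, and `F x ⊑ x` keeps it below `x`.
      -- It is thus one of the elements joined to form the kernel.
      kernel-fixed : ∀ {x} → F x ⊑ x → IsFixedPoint L F (kernel L F x)
      kernel-fixed {x} Fx⊑x = antisym
        (kernel-greatest (F-mono (kernel-postfixed x))
                         (trans (F-mono (kernel-reductive x)) Fx⊑x))
        (kernel-postfixed x)

      Gen-fixed : ∀ γ → IsFixedPoint L F (Gen L F γ)
      Gen-fixed γ = kernel-fixed (closure-prefixed γ)

proposition3p9 : ∀ {c ℓ₁ ℓ₂} (L : CompleteLattice c ℓ₁ ℓ₂) →
    let open CompleteLattice L in
    (⊤ ⊥ : Carrier) → Maximum _⊑_ ⊤ → Minimum _⊑_ ⊥ →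
    (F : Carrier → Carrier) → Monotonic₁ _⊑_ _⊑_ F →
    IsGreatestFixedPoint L F (Gen L F ⊤) × IsLeastFixedPoint L F (Gen L F ⊥)
proposition3p9 L ⊤ ⊥ ⊤-max ⊥-min F F-mono =
    ( Gen-fixed L F F-mono ⊤
    -- A fixed point is post-fixed and lies below `⊤ ⊑ closure L F ⊤`, so the kernel's supremum
    -- ranges over it.
    , λ y Fy≈y → kernel-greatest L F (reflexive (Eq.sym Fy≈y))
                   (trans (⊤-max y) (closure-extensive L F ⊤)) )
  , ( Gen-fixed L F F-mono ⊥
    -- Dually, a fixed point is pre-fixed and above `⊥`, so it bounds the closure, and the kernel
    -- only moves down.
    , λ y Fy≈y → trans (kernel-reductive L F _)
                   (closure-least L F (reflexive Fy≈y) (⊥-min y)) )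
  where open CompleteLattice L
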